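{- (Completeness of the classical-style semantics.) For any statement $s$, state $\sigma$, resumption $r:\mathit{res}$ and proof $h:r{\Updownarrow}$ of committedness of $r$, if $(s,\sigma)\Rightarrow r$, then $(s,\sigma)\Rightarrow_{\mathrm c}\mathit{norm}~r~h$.
   Context: Language. Given sets of variables $x$ and pure expressions $e$; values are integers; states $\sigma$ map variables to integers; $\sigma[x\mapsto v]$ is state update; $\llbracket e\rrbracket\sigma\in\mathbb Z$ is the value of $e$ in $\sigma$; $\sigma\models e$ means $\llbracket e\rrbracket\sigma\neq 0$. Statements: $s::=\mathsf{skip}\mid s_0;s_1\mid x:=e\mid\mathsf{if}~e~\mathsf{then}~s_t~\mathsf{else}~s_f\mid\mathsf{while}~e~\mathsf{do}~s_t\mid\mathsf{input}~x\mid\mathsf{output}~e$. Delayful resumptions $r:\mathit{res}$ are defined coinductively by the constructors $\mathit{ret}~\sigma$, $\mathit{in}~f$ ($f:\mathbb Z\to\mathit{res}$), $\mathit{out}~v~r$ ($v\in\mathbb Z$), $\delta~r$. Strong bisimilarity $\approx$ is defined coinductively: $\mathit{ret}~\sigma\approx\mathit{ret}~\sigma$; $\mathit{in}~f\approx\mathit{in}~f_*$ if $\forall v.\,f\,v\approx f_*\,v$; $\mathit{out}~v~r\approx\mathit{out}~v~r_*$ if $r\approx r_*$; $\delta~r\approx\delta~r_*$ if $r\approx r_*$. Classical-style resumptions $r:\mathit{res}_{\mathrm c}$ are defined coinductively by constructors $\mathit{ret}_{\mathrm c}~\sigma$, $\mathit{in}_{\mathrm c}~f$ ($f:\mathbb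 Z\to\mathit{res}_{\mathrm c}$), $\mathit{out}_{\mathrm c}~v~r$ ($v\in\mathbb Z$), and the constant $\bullet$ (silent divergence), with strong bisimilarity $\approx$ defined coinductively by the analogous congruence rules and $\bullet\approx\bullet$. Strongly bisimilar resumptions count as equal (setoids with equality $\approx$), and all relations on resumptions are understood to respect $\approx$. Convergence $r\downarrow r'$ on $\mathit{res}$ is inductive: $\mathit{ret}~\sigma\downarrow\mathit{ret}~\sigma$; $\mathit{in}~f\downarrow\mathit{in}~f_*$ if $\forall v.\,f\,v\approx f_*\,v$; $\mathit{out}~v~r\downarrow\mathit{out}~v~r_*$ if $r\approx r_*$; $\delta~r\downarrow r'$ if $r\downarrow r'$. Divergence $r\uparrow$ is coinductive: $(\delta~r)\uparrow$ if $r\uparrow$. Committedness $r{\Updownarrow}$ is a (proof-relevant) coinductive predicate with constructors: $\mathsf{comm\mbox{ - }ret}~\sigma~c$ proving $r{\Updownarrow}$ from $c:r\downarrow\mathit{ret}~\sigma$; $\mathsf{comm\mbox{ - }in}~f~c~k$ from $c:r\downarrow\mathit{in}~f$ and $k:\forall v.\,(f\,v){\Updownarrow}$; $\mathsf{comm\mbox{ - }out}~v~r'~c~h$ from $c:r\downarrow\mathit{out}~v~r'$ and $h:r'{\Updownarrow}$; $\mathsf{comm\mbox{ - }div}~d$ from $d:r\uparrow$. Normalization $\mathit{norm}:(r:\mathit{res})\to r{\Updownarrow}\to\mathit{res}_{\mathrm c}$ is defined corecursively by inspecting the proof: $\mathit{norm}~r~(\mathsf{comm\mbox{ - }ret}~\sigma~\_)=\mathit{ret}_{\mathrm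 c}~\sigma$; $\mathit{norm}~r~(\mathsf{comm\mbox{ - }in}~f~\_~k)=\mathit{in}_{\mathrm c}(\lambda v.\,\mathit{norm}~(f\,v)~(k\,v))$; $\mathit{norm}~r~(\mathsf{comm\mbox{ - }out}~v~r'~\_~h)=\mathit{out}_{\mathrm c}~v~(\mathit{norm}~r'~h)$; $\mathit{norm}~r~(\mathsf{comm\mbox{ - }div}~\_)=\bullet$. Delayful big-step semantics. Evaluation $(s,\sigma)\Rightarrow r$ and its extended evaluation, written here $(s,r)\Rightarrow^{\mathrm{ext}}r'$ (on $\mathit{res}$), are defined mutually coinductively by: $(x:=e,\sigma)\Rightarrow\delta(\mathit{ret}~\sigma[x\mapsto\llbracket e\rrbracket\sigma])$; $(\mathsf{skip},\sigma)\Rightarrow\mathit{ret}~\sigma$; $(s_0;s_1,\sigma)\Rightarrow r'$ if $(s_0,\sigma)\Rightarrow r$ and $(s_1,r)\Rightarrow^{\mathrm{ext}}r'$; $(\mathsf{if}~e~\mathsf{then}~s_t~\mathsf{else}~s_f,\sigma)\Rightarrow r$ if either $\sigma\models e$ and $(s_t,\delta(\mathit{ret}~\sigma))\Rightarrow^{\mathrm{ext}}r$, or $\sigma\not\models e$ and $(s_f,\delta(\mathit{ret}~\sigma))\Rightarrow^{\mathrm{ext}}r$; $(\mathsf{while}~e~\mathsf{do}~s_t,\sigma)\Rightarrow r'$ if $\sigma\models e$, $(s_t,\delta(\mathit{ret}~\sigma))\Rightarrow^{\mathrm{ext}}r$ and $(\mathsf{while}~e~\mathsf{do}~s_t,r)\Rightarrow^{\mathrm{ext}}r'$;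 $(\mathsf{while}~e~\mathsf{do}~s_t,\sigma)\Rightarrow\delta(\mathit{ret}~\sigma)$ if $\sigma\not\models e$; $(\mathsf{input}~x,\sigma)\Rightarrow\mathit{in}(\lambda v.\,\mathit{ret}~\sigma[x\mapsto v])$; $(\mathsf{output}~e,\sigma)\Rightarrow\mathit{out}~(\llbracket e\rrbracket\sigma)~(\mathit{ret}~\sigma)$; $(s,\mathit{ret}~\sigma)\Rightarrow^{\mathrm{ext}}r$ if $(s,\sigma)\Rightarrow r$; $(s,\mathit{in}~f)\Rightarrow^{\mathrm{ext}}\mathit{in}~f'$ if $\forall v.\,(s,f\,v)\Rightarrow^{\mathrm{ext}}f'\,v$; $(s,\mathit{out}~v~r)\Rightarrow^{\mathrm{ext}}\mathit{out}~v~r'$ if $(s,r)\Rightarrow^{\mathrm{ext}}r'$; $(s,\delta~r)\Rightarrow^{\mathrm{ext}}\delta~r'$ if $(s,r)\Rightarrow^{\mathrm{ext}}r'$. Classical-style big-step semantics. Let $X$ be a relation between pairs (statement, classical-style resumption) and classical-style resumptions, written $(s,r)\mathbin X r'$. The convergent evaluation $(s,\sigma)\mathbin{{\Rightarrow}{\downarrow}(X)}r$ ($r:\mathit{res}_{\mathrm c}$), abbreviated $(s,\sigma)\Downarrow_X r$, is defined inductively: $(x:=e,\sigma)\Downarrow_X\mathit{ret}_{\mathrm c}(\sigma[x\mapsto\llbracket e\rrbracket\sigma])$; $(\mathsf{skip},\sigma)\Downarrow_X\mathit{ret}_{\mathrm c}~\sigma$; $(s_0;s_1,\sigma)\Downarrow_X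 r$ if $(s_0,\sigma)\Downarrow_X\mathit{ret}_{\mathrm c}~\sigma'$ and $(s_1,\sigma')\Downarrow_X r$; $(s_0;s_1,\sigma)\Downarrow_X\mathit{in}_{\mathrm c}~f'$ if $(s_0,\sigma)\Downarrow_X\mathit{in}_{\mathrm c}~f$ and $\forall v.\,(s_1,f\,v)\mathbin X f'\,v$; $(s_0;s_1,\sigma)\Downarrow_X\mathit{out}_{\mathrm c}~v~r'$ if $(s_0,\sigma)\Downarrow_X\mathit{out}_{\mathrm c}~v~r$ and $(s_1,r)\mathbin X r'$; $(\mathsf{if}~e~\mathsf{then}~s_t~\mathsf{else}~s_f,\sigma)\Downarrow_X r$ if $\sigma\models e$ and $(s_t,\sigma)\Downarrow_X r$, or $\sigma\not\models e$ and $(s_f,\sigma)\Downarrow_X r$; with $w=\mathsf{while}~e~\mathsf{do}~s_t$: $(w,\sigma)\Downarrow_X r$ if $\sigma\models e$, $(s_t,\sigma)\Downarrow_X\mathit{ret}_{\mathrm c}~\sigma'$ and $(w,\sigma')\Downarrow_X r$; $(w,\sigma)\Downarrow_X\mathit{in}_{\mathrm c}~f'$ if $\sigma\models e$, $(s_t,\sigma)\Downarrow_X\mathit{in}_{\mathrm c}~f$ and $\forall v.\,(w,f\,v)\mathbin X f'\,v$; $(w,\sigma)\Downarrow_X\mathit{out}_{\mathrm c}~v~r'$ if $\sigma\models e$, $(s_t,\sigma)\Downarrow_X\mathit{out}_{\mathrm c}~v~r$ and $(w,r)\mathbin X r'$; $(w,\sigma)\Downarrow_X\mathit{ret}_{\mathrm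 c}~\sigma$ if $\sigma\not\models e$; $(\mathsf{input}~x,\sigma)\Downarrow_X\mathit{in}_{\mathrm c}(\lambda v.\,\mathit{ret}_{\mathrm c}~\sigma[x\mapsto v])$; $(\mathsf{output}~e,\sigma)\Downarrow_X\mathit{out}_{\mathrm c}~(\llbracket e\rrbracket\sigma)~(\mathit{ret}_{\mathrm c}~\sigma)$. The divergent evaluation $(s,\sigma)~{\Rightarrow}{\uparrow}(X)$, abbreviated $(s,\sigma)\Uparrow_X$, is defined coinductively: $(s_0;s_1,\sigma)\Uparrow_X$ if $(s_0,\sigma)\Uparrow_X$, or if $(s_0,\sigma)\Downarrow_X\mathit{ret}_{\mathrm c}~\sigma'$ and $(s_1,\sigma')\Uparrow_X$; $(\mathsf{if}~e~\mathsf{then}~s_t~\mathsf{else}~s_f,\sigma)\Uparrow_X$ if $\sigma\models e$ and $(s_t,\sigma)\Uparrow_X$, or $\sigma\not\models e$ and $(s_f,\sigma)\Uparrow_X$; $(\mathsf{while}~e~\mathsf{do}~s_t,\sigma)\Uparrow_X$ if $\sigma\models e$ and $(s_t,\sigma)\Uparrow_X$, or if $\sigma\models e$, $(s_t,\sigma)\Downarrow_X\mathit{ret}_{\mathrm c}~\sigma'$ and $(\mathsf{while}~e~\mathsf{do}~s_t,\sigma')\Uparrow_X$. Extended evaluation $(s,r)\stackrel{*}{\Rightarrow}r'$ on $\mathit{res}_{\mathrm c}$ is the coinductively defined (greatest) relation with rules: $(s,\mathit{ret}_{\mathrm c}~\sigma)\stackrel{*}{\Rightarrow}r$ if there is $X\subseteq{\stackrel{*}{\Rightarrow}}$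 with $(s,\sigma)\Downarrow_X r$; $(s,\mathit{ret}_{\mathrm c}~\sigma)\stackrel{*}{\Rightarrow}\bullet$ if there is $X\subseteq{\stackrel{*}{\Rightarrow}}$ with $(s,\sigma)\Uparrow_X$; $(s,\mathit{in}_{\mathrm c}~f)\stackrel{*}{\Rightarrow}\mathit{in}_{\mathrm c}~f'$ if $\forall v.\,(s,f\,v)\stackrel{*}{\Rightarrow}f'\,v$; $(s,\mathit{out}_{\mathrm c}~v~r)\stackrel{*}{\Rightarrow}\mathit{out}_{\mathrm c}~v~r'$ if $(s,r)\stackrel{*}{\Rightarrow}r'$; $(s,\bullet)\stackrel{*}{\Rightarrow}\bullet$. Finally, $(s,\sigma)\Rightarrow_{\mathrm c}r$ if $(s,\sigma)\mathbin{{\Rightarrow}{\downarrow}({\stackrel{*}{\Rightarrow}})}r$, and $(s,\sigma)\Rightarrow_{\mathrm c}\bullet$ if $(s,\sigma)~{\Rightarrow}{\uparrow}({\stackrel{*}{\Rightarrow}})$ (these are the only two rules). -}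

module Defs where

open import Level using (Level; _⊔_; 0ℓ) renaming (suc to lsuc)
open import Data.Bool.Base using () renaming (if_then_else_ to ifᵇ_then_else_)
open import Data.Integer.Base using (ℤ; 0ℤ)
open import Data.List.Base using (List; []; _∷_)
open import Data.Product.Base using (Σ; _×_; _,_)
open import Data.Unit.Base using (⊤; tt)
open import Relation.Binary.Definitions using (DecidableEquality; _Respects₂_)
open import Relation.Binary.PropositionalEquality.Core using (_≡_; _≢_; refl)
open import Relation.Nullary using (¬_; does)

private
  variable
    ℓ : Level

-- Proof-relevant coinductive predicates, without --guardedness: ν F is the
-- union of all post-fixed points of the rule functor F (Knaster-Tarski), so a
-- proof of ν F i is a coalgebra of F together with an element over i.  F is
-- always a data type strictly positive in its predicate argument, with one
-- constructor per rule.

record ν {a b} {I : Set a} (F : (I → Set) → I → Set b) (i : I)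
       : Set (a ⊔ b ⊔ lsuc 0ℓ) where
  field
    Carrier   : I → Set
    postfixed : ∀ {j} → Carrier j → F Carrier j
    seed      : Carrier i

record Language : Set₁ where
  infix 4 _≟_
  field
    Var Exp : Set
    _≟_     : DecidableEquality Var
    ⟦_⟧     : Exp → (Var → ℤ) → ℤ

module Semantics (L : Language) where
  open Language L

  State : Set
  State = Var → ℤ

  _[_↦_] : State → Var → ℤ → State
  (σ [ x ↦ v ]) y = ifᵇ does (x ≟ y) then v else σ y

  infix 4 _⊨_
  _⊨_ : State → Exp → Set
  σ ⊨ e = ⟦ e ⟧ σ ≢ 0ℤ

  infix  20 _:=_
  infixr 10 _⨟_
  data Stmt : Set where
    skip          : Stmt
    _⨟_           : Stmt → Stmt → Stmt
    _:=_          : Var → Exp → Stmt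
    if_then_else_ : Exp → Stmt → Stmt → Stmt
    while         : Exp → Stmt → Stmt
    input         : Var → Stmt
    output        : Exp → Stmt

  private
    variable
      e         : Exp
      s s₀ s₁   : Stmt
      sₜ sᶠ     : Stmt
      x         : Var
      v         : ℤ
      σ σ′      : State

  data Node (R : Set) : Set where
    ret : State → Node R
    inp : (ℤ → R) → Node R
    out : ℤ → R → Node R
    δ   : R → Node R

  shape : ∀ {R} → Node R → Node ⊤
  shape (ret σ)   = ret σ
  shape (inp _)   = inp (λ _ → tt)
  shape (out v _) = out v tt
  shape (δ _)     = δ tt

  -- The final coalgebra of Node up to strong bisimilarity: a non-wellfounded
  -- tree is the function giving the node shape at the end of each path.  A
  -- path has one integer per level: the value read at an inp node, and an
  -- arbitrary integer at out and δ nodes.  Only the 0ℤ branch is looked at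
  -- below out and δ, and nothing is looked at below ret; _≈_ ignores the rest.

  Res : Set
  Res = List ℤ → Node ⊤

  attach : ∀ {R} → Node ⊤ → (ℤ → R) → Node R
  attach (ret σ)   _ = ret σ
  attach (inp _)   g = inp g
  attach (out v _) g = out v (g 0ℤ)
  attach (δ _)     g = δ (g 0ℤ)

  -- step exposes the outermost constructor of a resumption, and fold turns a
  -- constructor application into a resumption.  Relations on resumptions are
  -- defined on outermost constructors (elements of Node Res), and hold of r
  -- when they hold of step r.

  step : Res → Node Res
  step r = attach (r []) (λ v p → r (v ∷ p))

  fold : Node Res → Res
  fold n         []      = shape n
  fold (ret σ)   (_ ∷ _) = ret σ
  fold (inp f)   (v ∷ p) = f v p
  fold (out _ r) (_ ∷ p) = r p
  fold (δ r)     (_ ∷ p) = r p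

  step-fold : ∀ n → step (fold n) ≡ n
  step-fold (ret _)   = refl
  step-fold (inp _)   = refl
  step-fold (out _ _) = refl
  step-fold (δ _)     = refl

  data BisimRule (P : Node Res × Node Res → Set) : Node Res × Node Res → Set where
    ret : BisimRule P (ret σ , ret σ)
    inp : ∀ {f f∗} → (∀ v → P (step (f v) , step (f∗ v))) →
          BisimRule P (inp f , inp f∗)
    out : ∀ {r r∗} → P (step r , step r∗) → BisimRule P (out v r , out v r∗)
    δ   : ∀ {r r∗} → P (step r , step r∗) → BisimRule P (δ r , δ r∗)

  infix 4 _≈_
  _≈_ : Res → Res → Set₁
  r ≈ r∗ = ν BisimRule (step r , step r∗)

  infix 4 _↓_
  data _↓_ : Node Res → Node Res → Set₁ where
    ret : ret σ ↓ ret σ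
    inp : ∀ {f f∗} → (∀ v → f v ≈ f∗ v) → inp f ↓ inp f∗
    out : ∀ {r r∗} → r ≈ r∗ → out v r ↓ out v r∗
    δ   : ∀ {r n} → step r ↓ n → δ r ↓ n

  data DivRule (P : Node Res → Set) : Node Res → Set where
    δ : ∀ {r} → P (step r) → DivRule P (δ r)

  infix 4 _↑
  _↑ : Res → Set₁
  r ↑ = ν DivRule (step r)

  data CommRule (P : Res → Set) (r : Res) : Set₁ where
    comm-ret : ∀ σ → step r ↓ ret σ → CommRule P r
    comm-in  : ∀ f → step r ↓ inp f → (∀ v → P (f v)) → CommRule P r
    comm-out : ∀ v r′ → step r ↓ out v r′ → P r′ → CommRule P r
    comm-div : r ↑ → CommRule P r

  infix 4 _⇕
  _⇕ : Res → Set₁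
  _⇕ = ν CommRule

  data Nodeᶜ (R : Set) : Set where
    ret : State → Nodeᶜ R
    inp : (ℤ → R) → Nodeᶜ R
    out : ℤ → R → Nodeᶜ R
    ●   : Nodeᶜ R

  shapeᶜ : ∀ {R} → Nodeᶜ R → Nodeᶜ ⊤
  shapeᶜ (ret σ)   = ret σ
  shapeᶜ (inp _)   = inp (λ _ → tt)
  shapeᶜ (out v _) = out v tt
  shapeᶜ ●         = ●

  Resᶜ : Set
  Resᶜ = List ℤ → Nodeᶜ ⊤

  attachᶜ : ∀ {R} → Nodeᶜ ⊤ → (ℤ → R) → Nodeᶜ R
  attachᶜ (ret σ)   _ = ret σ
  attachᶜ (inp _)   g = inp g
  attachᶜ (out v _) g = out v (g 0ℤ)
  attachᶜ ●         _ = ●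

  stepᶜ : Resᶜ → Nodeᶜ Resᶜ
  stepᶜ r = attachᶜ (r []) (λ v p → r (v ∷ p))

  foldᶜ : Nodeᶜ Resᶜ → Resᶜ
  foldᶜ n         []      = shapeᶜ n
  foldᶜ (ret σ)   (_ ∷ _) = ret σ
  foldᶜ (inp f)   (v ∷ p) = f v p
  foldᶜ (out _ r) (_ ∷ p) = r p
  foldᶜ ●         (_ ∷ _) = ●

  step-foldᶜ : ∀ n → stepᶜ (foldᶜ n) ≡ n
  step-foldᶜ (ret _)   = refl
  step-foldᶜ (inp _)   = refl
  step-foldᶜ (out _ _) = refl
  step-foldᶜ ●         = refl

  mapᶜ : ∀ {R R′} → (R → R′) → Nodeᶜ R → Nodeᶜ R′
  mapᶜ g (ret σ)   = ret σ
  mapᶜ g (inp f)   = inp (λ v → g (f v))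
  mapᶜ g (out v r) = out v (g r)
  mapᶜ g ●         = ●

  -- Corecursion into Resᶜ, characterised by step-unfoldᶜ.

  module _ {S : Set} (c : S → Nodeᶜ S) where
    unfoldᶜ  : S → Resᶜ
    followᶜ : Nodeᶜ S → Resᶜ
    unfoldᶜ q p = followᶜ (c q) p
    followᶜ n         []      = shapeᶜ n
    followᶜ (ret σ)   (_ ∷ _) = ret σ
    followᶜ (inp f)   (v ∷ p) = unfoldᶜ (f v) p
    followᶜ (out _ q) (_ ∷ p) = unfoldᶜ q p
    followᶜ ●         (_ ∷ _) = ●

    step-unfoldᶜ : ∀ q → stepᶜ (unfoldᶜ q) ≡ mapᶜ unfoldᶜ (c q)
    step-unfoldᶜ q with c q
    ... | ret _   = refl
    ... | inp _   = refl
    ... | out _ _ = refl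
    ... | ●       = refl

  data BisimRuleᶜ (P : Nodeᶜ Resᶜ × Nodeᶜ Resᶜ → Set) :
                  Nodeᶜ Resᶜ × Nodeᶜ Resᶜ → Set where
    ret : BisimRuleᶜ P (ret σ , ret σ)
    inp : ∀ {f f∗} → (∀ v → P (stepᶜ (f v) , stepᶜ (f∗ v))) →
          BisimRuleᶜ P (inp f , inp f∗)
    out : ∀ {r r∗} → P (stepᶜ r , stepᶜ r∗) → BisimRuleᶜ P (out v r , out v r∗)
    ●   : BisimRuleᶜ P (● , ●)

  infix 4 _≈ᶜ_
  _≈ᶜ_ : Resᶜ → Resᶜ → Set₁
  r ≈ᶜ r∗ = ν BisimRuleᶜ (stepᶜ r , stepᶜ r∗)

  -- The states of the corecursion are the resumptions paired with committedness
  -- evidence from the coalgebra supplied by h.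

  norm : (r : Res) → r ⇕ → Resᶜ
  norm r h = unfoldᶜ observe (r , seed)
    where
    open ν h

    emit : ∀ {r} → CommRule Carrier r → Nodeᶜ (Σ Res Carrier)
    emit (comm-ret σ _)      = ret σ
    emit (comm-in f _ k)     = inp (λ v → f v , k v)
    emit (comm-out v r′ _ k) = out v (r′ , k)
    emit (comm-div _)        = ●

    observe : Σ Res Carrier → Nodeᶜ (Σ Res Carrier)
    observe (_ , k) = emit (postfixed k)

  -- Evaluation and extended evaluation are mutually coinductive: one greatest
  -- fixed point over both forms of judgement.

  data Judgement : Set where
    eval : Stmt → State → Node Res → Judgement
    ext  : Stmt → Node Res → Node Res → Judgement

  -- Premises such as r ≈ fold (ret σ) in the rules without
  -- recursive premises make the relations respect _≈_ in the result.

  data EvalRule (P : Judgement → Set) : Judgement → Set₁ where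
    assign   : ∀ {r} → r ≈ fold (ret (σ [ x ↦ ⟦ e ⟧ σ ])) →
               EvalRule P (eval (x := e) σ (δ r))
    skip     : EvalRule P (eval skip σ (ret σ))
    seq      : ∀ {m n} → P (eval s₀ σ m) → P (ext s₁ m n) →
               EvalRule P (eval (s₀ ⨟ s₁) σ n)
    if-tt    : ∀ {n} → σ ⊨ e → P (ext sₜ (δ (fold (ret σ))) n) →
               EvalRule P (eval (if e then sₜ else sᶠ) σ n)
    if-ff    : ∀ {n} → ¬ σ ⊨ e → P (ext sᶠ (δ (fold (ret σ))) n) →
               EvalRule P (eval (if e then sₜ else sᶠ) σ n)
    while-tt : ∀ {m n} → σ ⊨ e → P (ext sₜ (δ (fold (ret σ))) m) →
               P (ext (while e sₜ) m n) →
               EvalRule P (eval (while e sₜ) σ n)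
    while-ff : ∀ {r} → ¬ σ ⊨ e → r ≈ fold (ret σ) →
               EvalRule P (eval (while e sₜ) σ (δ r))
    input    : ∀ {f} → (∀ v → f v ≈ fold (ret (σ [ x ↦ v ]))) →
               EvalRule P (eval (input x) σ (inp f))
    output   : ∀ {r} → r ≈ fold (ret σ) →
               EvalRule P (eval (output e) σ (out (⟦ e ⟧ σ) r))
    ext-ret  : ∀ {n} → P (eval s σ n) → EvalRule P (ext s (ret σ) n)
    ext-in   : ∀ {f f′} → (∀ v → P (ext s (step (f v)) (step (f′ v)))) →
               EvalRule P (ext s (inp f) (inp f′))
    ext-out  : ∀ {r r′} → P (ext s (step r) (step r′)) →
               EvalRule P (ext s (out v r) (out v r′))
    ext-δ    : ∀ {r r′} → P (ext s (step r) (step r′)) →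
               EvalRule P (ext s (δ r) (δ r′))

  infix 4 ⟨_,_⟩⇒_ ⟨_,_⟩⇒ext_
  ⟨_,_⟩⇒_ : Stmt → State → Res → Set₁
  ⟨ s , σ ⟩⇒ r = ν EvalRule (eval s σ (step r))

  ⟨_,_⟩⇒ext_ : Stmt → Res → Res → Set₁
  ⟨ s , r ⟩⇒ext r′ = ν EvalRule (ext s (step r) (step r′))

  infix 4 _⊢⟨_,_⟩⇓_
  data _⊢⟨_,_⟩⇓_ (X : Stmt → Resᶜ → Resᶜ → Set ℓ) :
                 Stmt → State → Nodeᶜ Resᶜ → Set (ℓ ⊔ lsuc 0ℓ) where
    assign    : X ⊢⟨ x := e , σ ⟩⇓ ret (σ [ x ↦ ⟦ e ⟧ σ ])
    skip      : X ⊢⟨ skip , σ ⟩⇓ ret σ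
    seq-ret   : ∀ {n} → X ⊢⟨ s₀ , σ ⟩⇓ ret σ′ → X ⊢⟨ s₁ , σ′ ⟩⇓ n →
                X ⊢⟨ s₀ ⨟ s₁ , σ ⟩⇓ n
    seq-in    : ∀ {f f′} → X ⊢⟨ s₀ , σ ⟩⇓ inp f → (∀ v → X s₁ (f v) (f′ v)) →
                X ⊢⟨ s₀ ⨟ s₁ , σ ⟩⇓ inp f′
    seq-out   : ∀ {r r′} → X ⊢⟨ s₀ , σ ⟩⇓ out v r → X s₁ r r′ →
                X ⊢⟨ s₀ ⨟ s₁ , σ ⟩⇓ out v r′
    if-tt     : ∀ {n} → σ ⊨ e → X ⊢⟨ sₜ , σ ⟩⇓ n →
                X ⊢⟨ if e then sₜ else sᶠ , σ ⟩⇓ n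
    if-ff     : ∀ {n} → ¬ σ ⊨ e → X ⊢⟨ sᶠ , σ ⟩⇓ n →
                X ⊢⟨ if e then sₜ else sᶠ , σ ⟩⇓ n
    while-ret : ∀ {n} → σ ⊨ e → X ⊢⟨ sₜ , σ ⟩⇓ ret σ′ →
                X ⊢⟨ while e sₜ , σ′ ⟩⇓ n →
                X ⊢⟨ while e sₜ , σ ⟩⇓ n
    while-in  : ∀ {f f′} → σ ⊨ e → X ⊢⟨ sₜ , σ ⟩⇓ inp f →
                (∀ v → X (while e sₜ) (f v) (f′ v)) →
                X ⊢⟨ while e sₜ , σ ⟩⇓ inp f′
    while-out : ∀ {r r′} → σ ⊨ e → X ⊢⟨ sₜ , σ ⟩⇓ out v r →
                X (while e sₜ) r r′ →
                X ⊢⟨ while e sₜ , σ ⟩⇓ out v r′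
    while-ff  : ¬ σ ⊨ e → X ⊢⟨ while e sₜ , σ ⟩⇓ ret σ
    input     : ∀ {f} → (∀ v → f v ≈ᶜ foldᶜ (ret (σ [ x ↦ v ]))) →
                X ⊢⟨ input x , σ ⟩⇓ inp f
    output    : ∀ {r} → r ≈ᶜ foldᶜ (ret σ) →
                X ⊢⟨ output e , σ ⟩⇓ out (⟦ e ⟧ σ) r

  data DivRuleᶜ (X : Stmt → Resᶜ → Resᶜ → Set ℓ) (P : Stmt × State → Set) :
                Stmt × State → Set (ℓ ⊔ lsuc 0ℓ) where
    seq-div    : P (s₀ , σ) → DivRuleᶜ X P (s₀ ⨟ s₁ , σ)
    seq-ret    : X ⊢⟨ s₀ , σ ⟩⇓ ret σ′ → P (s₁ , σ′) →
                 DivRuleᶜ X P (s₀ ⨟ s₁ , σ)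
    if-tt      : σ ⊨ e → P (sₜ , σ) → DivRuleᶜ X P (if e then sₜ else sᶠ , σ)
    if-ff      : ¬ σ ⊨ e → P (sᶠ , σ) → DivRuleᶜ X P (if e then sₜ else sᶠ , σ)
    while-body : σ ⊨ e → P (sₜ , σ) → DivRuleᶜ X P (while e sₜ , σ)
    while-ret  : σ ⊨ e → X ⊢⟨ sₜ , σ ⟩⇓ ret σ′ → P (while e sₜ , σ′) →
                 DivRuleᶜ X P (while e sₜ , σ)

  infix 4 _⊢⟨_,_⟩⇑
  _⊢⟨_,_⟩⇑ : (Stmt → Resᶜ → Resᶜ → Set ℓ) → Stmt → State → Set (ℓ ⊔ lsuc 0ℓ)
  X ⊢⟨ s , σ ⟩⇑ = ν (DivRuleᶜ X) (s , σ)

  record _SubrelationOf_ (X : Stmt → Resᶜ → Resᶜ → Set)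
                         (P : Stmt × Nodeᶜ Resᶜ × Nodeᶜ Resᶜ → Set) : Set₁ where
    field
      respects-≈ᶜ : ∀ s → X s Respects₂ _≈ᶜ_
      included    : ∀ {s r r′} → X s r r′ → P (s , stepᶜ r , stepᶜ r′)

  -- X ranges over Set-valued relations, whereas _⊢⟨_,_⟩⇓_ and _⊢⟨_,_⟩⇑ are
  -- level-polymorphic in X so that Evalᶜ can use them at ⟨_,_⟩⇒*_ itself.

  data ExtRuleᶜ (P : Stmt × Nodeᶜ Resᶜ × Nodeᶜ Resᶜ → Set) :
                Stmt × Nodeᶜ Resᶜ × Nodeᶜ Resᶜ → Set₁ where
    ret-conv : ∀ {n} X → X SubrelationOf P → X ⊢⟨ s , σ ⟩⇓ n →
               ExtRuleᶜ P (s , ret σ , n)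
    ret-div  : ∀ X → X SubrelationOf P → X ⊢⟨ s , σ ⟩⇑ →
               ExtRuleᶜ P (s , ret σ , ●)
    ext-in   : ∀ {f f′} → (∀ v → P (s , stepᶜ (f v) , stepᶜ (f′ v))) →
               ExtRuleᶜ P (s , inp f , inp f′)
    ext-out  : ∀ {r r′} → P (s , stepᶜ r , stepᶜ r′) →
               ExtRuleᶜ P (s , out v r , out v r′)
    ext-●    : ExtRuleᶜ P (s , ● , ●)

  infix 4 ⟨_,_⟩⇒*_
  ⟨_,_⟩⇒*_ : Stmt → Resᶜ → Resᶜ → Set₁
  ⟨ s , r ⟩⇒* r′ = ν ExtRuleᶜ (s , stepᶜ r , stepᶜ r′)

  data Evalᶜ (s : Stmt) (σ : State) : Nodeᶜ Resᶜ → Set₁ where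
    conv : ∀ {n} → ⟨_,_⟩⇒*_ ⊢⟨ s , σ ⟩⇓ n → Evalᶜ s σ n
    div  : ⟨_,_⟩⇒*_ ⊢⟨ s , σ ⟩⇑ → Evalᶜ s σ ●

  infix 4 ⟨_,_⟩⇒ᶜ_
  ⟨_,_⟩⇒ᶜ_ : Stmt → State → Resᶜ → Set₁
  ⟨ s , σ ⟩⇒ᶜ r = Evalᶜ s σ (stepᶜ r)

{-# OPTIONS --safe #-}
-- Excluded middle makes every resumption converge or diverge, so every
-- resumption is committed and has a normal form, which is unique up to ≈ᶜ.
-- The classical-style evaluations relate the normal forms of the resumptions
-- that the delayful evaluation relates.  A convergent evaluation is built by
-- lexicographic induction on the number of delays that the result performs and
-- on the statement: an iteration of a while-loop costs at least one delay, and
-- everything else passes to a substatement.  In a divergent evaluation, a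
-- sequence (or loop iteration) diverges either in its first component, or
-- after that component has returned.
module Submission where

open import Defs
open import Level using (Level; 0ℓ)
open import Axiom.ExcludedMiddle using (ExcludedMiddle)
open import Data.Empty using (⊥-elim)
open import Data.Integer.Base using (ℤ)
open import Data.Nat.Base using (ℕ; zero; suc; _≤_; z≤n; s≤s)
open import Data.Nat.Properties using (≤-refl; ≤-trans; m≤n⇒m≤1+n)
open import Data.Product.Base using (Σ; ∃-syntax; _×_; _,_)
open import Data.Unit.Base using (⊤; tt)
open import Relation.Binary.PropositionalEquality using (_≡_; refl)
open import Relation.Nullary using (¬_; yes; no)

module Normalization (L : Language) where
  open Semantics L

  private
    variable
      k             : ℕ
      s             : Stmt
      σ             : State
      v             : ℤ
      m m′ n n′ n″  : Node Res
      a b           : Nodeᶜ Resᶜ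
      f             : ℤ → Res
      r             : Res

  -- Bisimilarity and changing the seed of a coalgebra.

  ≈-refl : ν BisimRule (n , n)
  ≈-refl = record { Carrier = λ (n , n′) → n ≡ n′ ; postfixed = refl-rule ; seed = refl }
    where
    refl-rule : ∀ {p} → (λ (n , n′) → n ≡ n′) p → BisimRule (λ (n , n′) → n ≡ n′) p
    refl-rule {ret _ , _}   refl = ret
    refl-rule {inp _ , _}   refl = inp λ _ → refl
    refl-rule {out _ _ , _} refl = out refl
    refl-rule {δ _ , _}     refl = δ refl

  ≈-trans : ν BisimRule (n , n′) → ν BisimRule (n′ , n″) → ν BisimRule (n , n″)
  ≈-trans p q = record
    { Carrier   = Composite
    ; postfixed = λ (_ , c , d) → compose (P.postfixed c) (Q.postfixed d)
    ; seed      = _ , P.seed , Q.seed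
    }
    where
    module P = ν p
    module Q = ν q

    Composite : Node Res × Node Res → Set
    Composite (n , n″) = ∃[ n′ ] P.Carrier (n , n′) × Q.Carrier (n′ , n″)

    compose : ∀ {n n′ n″} → BisimRule P.Carrier (n , n′) →
              BisimRule Q.Carrier (n′ , n″) → BisimRule Composite (n , n″)
    compose ret     ret     = ret
    compose (inp c) (inp d) = inp λ v → _ , c v , d v
    compose (out c) (out d) = out (_ , c , d)
    compose (δ c)   (δ d)   = δ (_ , c , d)

  ret-≈ᶜ : ν BisimRuleᶜ (ret σ , ret σ)
  ret-≈ᶜ {σ} = record { Carrier   = λ p → p ≡ (ret σ , ret σ)
                      ; postfixed = λ { refl → ret }
                      ; seed      = refl }

  reseed : ∀ {a b} {I : Set a} {F : (I → Set) → I → Set b} {i j} →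
           (x : ν F i) → ν.Carrier x j → ν F j
  reseed x c = record { Carrier = ν.Carrier x ; postfixed = ν.postfixed x ; seed = c }

  -- Convergence with counted delays, and divergence.

  -- Unlike _↓_, this relation is small and stops exactly at the constructor
  -- found, not up to ≈, so that it can occur in carriers of ν.
  infix 4 _⇣[_]_
  data _⇣[_]_ : Node Res → ℕ → Node Res → Set where
    ret : ret σ ⇣[ 0 ] ret σ
    inp : inp f ⇣[ 0 ] inp f
    out : out v r ⇣[ 0 ] out v r
    δ   : step r ⇣[ k ] n → δ r ⇣[ suc k ] n

  -- Negated convergence stands in for `_↑`, which lies in `Set₁` and so cannot occur in the
  -- carriers of `ν`.
  Converges Diverges : Node Res → Set
  Converges n = ∃[ k ] ∃[ m ] n ⇣[ k ] m
  Diverges n  = ¬ Converges n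

  Diverges-δ : Diverges (δ r) → Diverges (step r)
  Diverges-δ d (_ , _ , c) = d (_ , _ , δ c)

  ⇣-deterministic : ∀ {j k} → n ⇣[ j ] m → n ⇣[ k ] m′ → m ≡ m′
  ⇣-deterministic ret   ret   = refl
  ⇣-deterministic inp   inp   = refl
  ⇣-deterministic out   out   = refl
  ⇣-deterministic (δ c) (δ d) = ⇣-deterministic c d

  ⇣⇒↓ : n ⇣[ k ] m → n ↓ m
  ⇣⇒↓ ret   = ret
  ⇣⇒↓ inp   = inp λ _ → ≈-refl
  ⇣⇒↓ out   = out ≈-refl
  ⇣⇒↓ (δ c) = δ (⇣⇒↓ c)

  data Aligned : Node Res → Node Res → Set₁ where
    ret : Aligned (ret σ) (ret σ)
    inp : ∀ {f f′} → (∀ v → f v ≈ f′ v) → Aligned (inp f) (inp f′)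
    out : ∀ {r r′} → r ≈ r′ → Aligned (out v r) (out v r′)

  -- Committedness evidence continues from subresumptions that are only bisimilar to the ones
  -- actually reached. Starting from a bisimilar `n` and ending in `Aligned` lets this step be
  -- iterated along such evidence.
  ↓⇒⇣ : ν BisimRule (n , n′) → n′ ↓ m → ∃[ k ] ∃[ m′ ] n ⇣[ k ] m′ × Aligned m′ m
  ↓⇒⇣ b c with ν.postfixed b (ν.seed b)
  ↓⇒⇣ b ret     | ret   = _ , _ , ret , ret
  ↓⇒⇣ b (inp p) | inp q = _ , _ , inp , inp λ v → ≈-trans (reseed b (q v)) (p v)
  ↓⇒⇣ b (out p) | out q = _ , _ , out , out (≈-trans (reseed b q) p)
  ↓⇒⇣ b (δ c)   | δ q with ↓⇒⇣ (reseed b q) c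
  ... | _ , _ , d , al = _ , _ , δ d , al

  ↑⇒Diverges : ν BisimRule (n , n′) → ν DivRule n′ → Diverges n
  ↑⇒Diverges b d (_ , _ , c) = never b d c
    where
    never : ∀ {n n′ k m} → ν BisimRule (n , n′) → ν DivRule n′ → ¬ n ⇣[ k ] m
    never b d c with ν.postfixed d (ν.seed d)
    ... | δ d′ with ν.postfixed b (ν.seed b)
    never b d (δ c) | δ d′ | δ b′ = never (reseed b b′) (reseed d d′) c

  -- Normal forms as a relation.

  data Matches (P : Node Res → Nodeᶜ Resᶜ → Set) : Node Res → Nodeᶜ Resᶜ → Set where
    ret : Matches P (ret σ) (ret σ)
    inp : ∀ {f g} → (∀ v → P (step (f v)) (stepᶜ (g v))) → Matches P (inp f) (inp g)
    out : ∀ {r q} → P (step r) (stepᶜ q) → Matches P (out v r) (out v q)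

  data NormalRule (P : Node Res → Nodeᶜ Resᶜ → Set) (n : Node Res) :
                  Nodeᶜ Resᶜ → Set where
    conv : n ⇣[ k ] m → Matches P m a → NormalRule P n a
    div  : Diverges n → NormalRule P n ●

  -- Normal is ν NormalRule as the limit of its finite approximations, because
  -- ν itself would be too large for a carrier.

  NormalTo : ℕ → Node Res → Nodeᶜ Resᶜ → Set
  NormalTo zero    _ _ = ⊤
  NormalTo (suc k) n a = NormalRule (NormalTo k) n a

  Normal : Node Res → Nodeᶜ Resᶜ → Set
  Normal n a = ∀ k → NormalTo k n a

  -- Since `_⇣[_]_` is deterministic, all approximations expose the same node, so their premises can
  -- be collected child by child. The first approximation already decides between `conv` and `div`.
  Normal-unfold : Normal n a → NormalRule Normal n a
  Normal-unfold {n} h with h 1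
  ... | div d = div d
  ... | conv {m = m} c x = conv c (limit x at)
    where
    at : ∀ k → Matches (NormalTo k) m _
    at k with h (suc k)
    ... | div d = ⊥-elim (d (_ , _ , c))
    ... | conv c′ y with ⇣-deterministic c c′
    ... | refl = y

    limit : Matches (NormalTo 0) m a → (∀ k → Matches (NormalTo k) m a) →
            Matches Normal m a
    limit ret     _  = ret
    limit (inp _) at = inp λ v k → inp⁻¹ (at k) v
      where
      inp⁻¹ : ∀ {P f g} → Matches P (inp f) (inp g) → ∀ v → P (step (f v)) (stepᶜ (g v))
      inp⁻¹ (inp y) = y
    limit (out _) at = out λ k → out⁻¹ (at k)
      where
      out⁻¹ : ∀ {P r q} → Matches P (out v r) (out v q) → P (step r) (stepᶜ q)
      out⁻¹ (out y) = y

  Normal-respects-≈ᶜ : ν BisimRuleᶜ (a , b) → Normal n a → Normal n b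
  Normal-respects-≈ᶜ p h k = respects k p (h k)
    where
    respects : ∀ k {n a b} → ν BisimRuleᶜ (a , b) → NormalTo k n a → NormalTo k n b
    respects zero    _ _ = tt
    respects (suc k) p h with ν.postfixed p (ν.seed p)
    respects (suc k) p (conv c ret)     | ret   = conv c ret
    respects (suc k) p (conv c (inp x)) | inp q =
      conv c (inp λ v → respects k (reseed p (q v)) (x v))
    respects (suc k) p (conv c (out x)) | out q = conv c (out (respects k (reseed p q) x))
    respects (suc k) p (div d)          | ●     = div d

  -- The result of `norm` is a normal form.

  coalgebra-of : ∀ {S} {c : S → Nodeᶜ S} {q} (r : Resᶜ) → r ≡ unfoldᶜ c q → S → Nodeᶜ S
  coalgebra-of {c = c} _ _ = c

  module _ (r : Res) (h : r ⇕) where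
    open ν h

    -- The coalgebra local to norm, recovered by unification.
    observe : Σ Res Carrier → Nodeᶜ (Σ Res Carrier)
    observe = coalgebra-of {q = r , seed} (norm r h) refl

    -- Induction on the depth `j` of approximation. It is stated for any `n` bisimilar to `step r′`,
    -- because the evidence held in `k` describes the children of `n` only up to bisimilarity.
    unfold-Normal : ∀ j {r′} (k : Carrier r′) → ν BisimRule (n , step r′) →
                    NormalTo j n (stepᶜ (unfoldᶜ observe (r′ , k)))
    unfold-Normal zero    k b = tt
    unfold-Normal (suc j) {r′} k b rewrite step-unfoldᶜ observe (r′ , k) with postfixed k
    ... | comm-div d = div (↑⇒Diverges b d)
    ... | comm-ret σ c with ↓⇒⇣ b c
    ...   | _ , _ , c′ , ret = conv c′ ret
    unfold-Normal (suc j) k b | comm-in f c k′ with ↓⇒⇣ b c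
    ...   | _ , _ , c′ , inp p = conv c′ (inp λ v → unfold-Normal j (k′ v) (p v))
    unfold-Normal (suc j) k b | comm-out v r′ c k′ with ↓⇒⇣ b c
    ...   | _ , _ , c′ , out p = conv c′ (out (unfold-Normal j k′ p))

    norm-Normal : Normal (step r) (stepᶜ (norm r h))
    norm-Normal j = unfold-Normal j seed ≈-refl

  -- Normal forms of all resumptions, by excluded middle.

  module Classical (em : ExcludedMiddle 0ℓ) where

    Diverges⇒↑ : Diverges n → ν DivRule n
    Diverges⇒↑ d = record { Carrier = Diverges ; postfixed = diverge ; seed = d }
      where
      diverge : ∀ {n} → Diverges n → DivRule Diverges n
      diverge {ret _}   d = ⊥-elim (d (_ , _ , ret))
      diverge {inp _}   d = ⊥-elim (d (_ , _ , inp))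
      diverge {out _ _} d = ⊥-elim (d (_ , _ , out))
      diverge {δ _}     d = δ (Diverges-δ d)

    ⇣-not-δ : ¬ n ⇣[ k ] δ r
    ⇣-not-δ (δ c) = ⇣-not-δ c

    -- Convergence is decided afresh at every resumption, so no evidence is carried along and the
    -- constant carrier `⊤` suffices.
    committed : ∀ r → r ⇕
    committed r = record { Carrier = λ _ → ⊤ ; postfixed = λ _ → commit _ ; seed = tt }
      where
      commit : ∀ r → CommRule (λ _ → ⊤) r
      commit r with em {Converges (step r)}
      ... | no d                 = comm-div (Diverges⇒↑ d)
      ... | yes (_ , ret _ , c)   = comm-ret _ (⇣⇒↓ c)
      ... | yes (_ , inp _ , c)   = comm-in _ (⇣⇒↓ c) _
      ... | yes (_ , out _ _ , c) = comm-out _ _ (⇣⇒↓ c) _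
      ... | yes (_ , δ _ , c)     = ⊥-elim (⇣-not-δ c)

    normalForm : Res → Resᶜ
    normalForm r = norm r (committed r)

    normalForm-Normal : ∀ r → Normal (step r) (stepᶜ (normalForm r))
    normalForm-Normal r = norm-Normal r (committed r)

  -- Inversion of delayful evaluations.

  module Evaluation (E : Judgement → Set) (rule : ∀ {J} → E J → EvalRule E J) where

    private
      variable
        i j : ℕ

    -- Branches and loop bodies start from `δ (fold (ret σ))`, and extended evaluation copies that
    -- delay to the result. This is the delay that pays for a loop iteration.
    delayed : E (ext s (δ (fold (ret σ))) n) → ∃[ r ] n ≡ δ r × E (eval s σ (step r))
    delayed e with rule e
    ... | ext-δ e′ with rule e′
    ...   | ext-ret e″ = _ , refl , e″

    -- Accounts for the delays of a composite result: extended evaluation copies those of `m` and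
    -- then adds those of the continuation, so each share is at most `k`. At an input or output the
    -- continuation is left unevaluated.
    data Split (s : Stmt) (k : ℕ) : Node Res → Node Res → Node Res → Set where
      ret : m ⇣[ i ] ret σ → i ≤ k → E (eval s σ n′) → n′ ⇣[ j ] m′ → j ≤ k →
            Split s k m n m′
      inp : ∀ {f f′} → m ⇣[ i ] inp f → i ≤ k →
            (∀ v → E (ext s (step (f v)) (step (f′ v)))) → Split s k m n (inp f′)
      out : ∀ {r r′} → m ⇣[ i ] out v r → i ≤ k →
            E (ext s (step r) (step r′)) → Split s k m n (out v r′)

    split : E (ext s m n) → n ⇣[ k ] m′ → Split s k m n m′
    split e c with rule e
    -- The first resumption has already returned, so all `k` delays belong to the continuation.
    split e c     | ext-ret e′ = ret ret z≤n e′ c ≤-refl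
    split e inp   | ext-in e′  = inp inp z≤n e′
    split e out   | ext-out e′ = out out z≤n e′
    split e (δ c) | ext-δ e′ with split e′ c
    ... | ret c₁ p e″ c₂ q = ret (δ c₁) (s≤s p) e″ c₂ (m≤n⇒m≤1+n q)
    ... | inp c₁ p e″      = inp (δ c₁) (s≤s p) e″
    ... | out c₁ p e″      = out (δ c₁) (s≤s p) e″

    Split⇒Converges : Split s k m n m′ → Converges m
    Split⇒Converges (ret c _ _ _ _) = _ , _ , c
    Split⇒Converges (inp c _ _)     = _ , _ , c
    Split⇒Converges (out c _ _)     = _ , _ , c

    ext-Diverges : E (ext s m n) → Diverges m → Diverges n
    ext-Diverges e d (_ , _ , c) = d (Split⇒Converges (split e c))

    -- Extended evaluation copies inputs and outputs, so if `m` converged to one of these, `n` would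
    -- converge as well. Hence `m` returns, and the divergence lies in the continuation.
    split-div : E (ext s m n) → m ⇣[ k ] m′ → Diverges n →
                ∃[ σ ] ∃[ n′ ] m′ ≡ ret σ × E (eval s σ n′) × Diverges n′
    split-div e c d with rule e
    split-div e ret   d | ext-ret e′ = _ , _ , refl , e′ , d
    split-div e inp   d | ext-in _   = ⊥-elim (d (_ , _ , inp))
    split-div e out   d | ext-out _  = ⊥-elim (d (_ , _ , out))
    split-div e (δ c) d | ext-δ e′   = split-div e′ c (Diverges-δ d)

    -- Built on the small coalgebra `E` rather than on `ν EvalRule`, so that it can itself be the
    -- carrier for `ExtRuleᶜ`.
    Ext : Stmt × Nodeᶜ Resᶜ × Nodeᶜ Resᶜ → Set
    Ext (s , a , b) = ∃[ n ] ∃[ m ] E (ext s n m) × Normal n a × Normal m b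

    -- Convergent and divergent evaluation over a relation including `Ext`.

    module _ (em : ExcludedMiddle 0ℓ) {ℓ : Level} {X : Stmt → Resᶜ → Resᶜ → Set ℓ}
             (Ext⊆X : ∀ {s} r r′ → Ext (s , stepᶜ r , stepᶜ r′) → X s r r′) where
      open Classical em

      -- The delayful evaluation provides no classical-style intermediate resumption, so
      -- `normalForm r` is chosen for it.
      X-intro : ∀ {r q} → E (ext s (step r) n) → Normal n (stepᶜ q) → X s (normalForm r) q
      X-intro {r = r} e h = Ext⊆X _ _ (_ , _ , e , normalForm-Normal r , h)

      ret-Matches : ν BisimRule (n , ret σ) → n ⇣[ k ] m → Matches Normal m a → a ≡ ret σ
      ret-Matches p c x with ν.postfixed p (ν.seed p)
      ret-Matches p ret ret | ret = refl

      ret-Normal : ν BisimRule (n , ret σ) → Normal n a → ν BisimRuleᶜ (a , ret σ)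
      ret-Normal p h with ν.postfixed p (ν.seed p)
      ... | ret with Normal-unfold h
      ...   | conv ret ret = ret-≈ᶜ
      ...   | div d        = ⊥-elim (d (_ , _ , ret))

      inp-Matches : ∀ f → Matches Normal (inp f) (inp λ v → normalForm (f v))
      inp-Matches f = inp λ v → normalForm-Normal (f v)

      out-Matches : ∀ r → Matches Normal (out v r) (out v (normalForm r))
      out-Matches r = out (normalForm-Normal r)

      -- The recursion descends on the bound `k` rather than on `j`, since the shares given by
      -- `split` are only known to be at most `k`. A sequence keeps `k` and passes to its
      -- components.
      converge : ∀ k s → j ≤ k → E (eval s σ n) → n ⇣[ j ] m → Matches Normal m a →
                 X ⊢⟨ s , σ ⟩⇓ a
      converge k s j≤k e c x with rule e
      converge k skip _ _ ret ret | skip = skip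
      converge k (_ := _) _ _ (δ c) x | assign p with ret-Matches p c x
      ... | refl = assign
      converge k (input _) _ _ inp (inp x) | input p = input λ v → ret-Normal (p v) (x v)
      converge k (output _) _ _ out (out x) | output p = output (ret-Normal p x)
      converge k (s₀ ⨟ s₁) j≤k _ c x | seq e₀ e₁ with split e₁ c
      ... | ret c₀ p e′ c₁ q =
            seq-ret (converge k s₀ (≤-trans p j≤k) e₀ c₀ ret)
                    (converge k s₁ (≤-trans q j≤k) e′ c₁ x)
      converge k (s₀ ⨟ s₁) j≤k _ c (inp x) | seq e₀ e₁ | inp c₀ p e′ =
        seq-in (converge k s₀ (≤-trans p j≤k) e₀ c₀ (inp-Matches _))
               λ v → X-intro (e′ v) (x v)
      converge k (s₀ ⨟ s₁) j≤k _ c (out x) | seq e₀ e₁ | out c₀ p e′ =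
        seq-out (converge k s₀ (≤-trans p j≤k) e₀ c₀ (out-Matches _))
                (X-intro e′ x)
      converge k (if _ then sₜ else _) _ _ _ _ | if-tt t e′ with delayed e′
      converge (suc k) (if _ then sₜ else _) (s≤s j≤k) _ (δ c) x
        | if-tt t _ | _ , refl , e″ = if-tt t (converge k sₜ j≤k e″ c x)
      converge k (if _ then _ else sᶠ) _ _ _ _ | if-ff t e′ with delayed e′
      converge (suc k) (if _ then _ else sᶠ) (s≤s j≤k) _ (δ c) x
        | if-ff t _ | _ , refl , e″ = if-ff t (converge k sᶠ j≤k e″ c x)
      converge k (while _ _) _ _ (δ c) x | while-ff t p with ret-Matches p c x
      ... | refl = while-ff t
      converge k (while _ _) _ _ _ _ | while-tt t e₀ e₁ with delayed e₀
      ... | _ , refl , _ with rule e₁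
      -- The delay before the body is also the first delay of the result. Removing it lowers the
      -- bound, which permits the recursive call on the same loop.
      converge (suc k) (while _ sₜ) (s≤s j≤k) _ (δ c) _
        | while-tt t _ _ | _ , refl , e₀′ | ext-δ e₁′ with split e₁′ c
      converge (suc k) (while e sₜ) (s≤s j≤k) _ (δ _) x
        | while-tt t _ _ | _ , refl , e₀′ | ext-δ _ | ret c₀ p e′ c₁ q =
          while-ret t (converge k sₜ (≤-trans p j≤k) e₀′ c₀ ret)
                      (converge k (while e sₜ) (≤-trans q j≤k) e′ c₁ x)
      converge (suc k) (while _ sₜ) (s≤s j≤k) _ (δ _) (inp x)
        | while-tt t _ _ | _ , refl , e₀′ | ext-δ _ | inp c₀ p e′ =
          while-in t (converge k sₜ (≤-trans p j≤k) e₀′ c₀ (inp-Matches _))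
                     λ v → X-intro (e′ v) (x v)
      converge (suc k) (while _ sₜ) (s≤s j≤k) _ (δ _) (out x)
        | while-tt t _ _ | _ , refl , e₀′ | ext-δ _ | out c₀ p e′ =
          while-out t (converge k sₜ (≤-trans p j≤k) e₀′ c₀ (out-Matches _))
                      (X-intro e′ x)

      Divergent : Stmt × State → Set
      Divergent (s , σ) = ∃[ n ] E (eval s σ n) × Diverges n

      ret-Converges : ν BisimRule (n , ret σ) → Converges n
      ret-Converges p with ν.postfixed p (ν.seed p)
      ... | ret = _ , _ , ret

      -- The evaluation itself does not tell which component diverges. Excluded middle decides
      -- whether the first one converges; if it does, `split-div` shows that it returns.
      diverge : E (eval s σ n) → Diverges n → DivRuleᶜ X Divergent (s , σ)
      diverge e d with rule e
      ... | skip         = ⊥-elim (d (_ , _ , ret))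
      ... | assign p     = ⊥-elim (Diverges-δ d (ret-Converges p))
      ... | while-ff _ p = ⊥-elim (Diverges-δ d (ret-Converges p))
      ... | input _      = ⊥-elim (d (_ , _ , inp))
      ... | output _     = ⊥-elim (d (_ , _ , out))
      ... | if-tt t e′ with delayed e′
      ...   | _ , refl , e″ = if-tt t (_ , e″ , Diverges-δ d)
      diverge e d | if-ff t e′ with delayed e′
      ...   | _ , refl , e″ = if-ff t (_ , e″ , Diverges-δ d)
      diverge e d | seq {m = m} e₀ e₁ with em {Converges m}
      ... | no d₀ = seq-div (_ , e₀ , d₀)
      ... | yes (_ , _ , c₀) with split-div e₁ c₀ d
      ...   | _ , _ , refl , e′ , d′ = seq-ret (converge _ _ ≤-refl e₀ c₀ ret) (_ , e′ , d′)
      diverge e d | while-tt t e₀ e₁ with delayed e₀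
      ... | r , refl , e₀′ with em {Converges (step r)}
      ...   | no d₀ = while-body t (_ , e₀′ , d₀)
      -- `c₀` concerns the body without its initial delay, whereas `e₁` starts from `δ r`; the delay
      -- is put back here.
      ...   | yes (_ , _ , c₀) with split-div e₁ (δ c₀) d
      ...     | _ , _ , refl , e′ , d′ = while-ret t (converge _ _ ≤-refl e₀′ c₀ ret) (_ , e′ , d′)

      diverges : E (eval s σ n) → Diverges n → X ⊢⟨ s , σ ⟩⇑
      diverges e d = record { Carrier   = Divergent
                            ; postfixed = λ (_ , e , d) → diverge e d
                            ; seed      = _ , e , d }

    -- Extended evaluation and the conclusion.

    module _ (em : ExcludedMiddle 0ℓ) where

      -- The rules `ret-conv` and `ret-div` require a `Set`-valued relation, which excludes
      -- `⟨_,_⟩⇒*_`; this small relation is used there instead.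
      ExtRel : Stmt → Resᶜ → Resᶜ → Set
      ExtRel s r r′ = Ext (s , stepᶜ r , stepᶜ r′)

      ExtRel⊆Ext : ExtRel SubrelationOf Ext
      ExtRel⊆Ext = record
        { respects-≈ᶜ = λ s →
            (λ p (n , m , e , h , h′) → n , m , e , h , Normal-respects-≈ᶜ p h′) ,
            (λ p (n , m , e , h , h′) → n , m , e , Normal-respects-≈ᶜ p h , h′)
        ; included = λ x → x
        }

      -- Convergence or divergence of the two sides selects the rule. When both converge,
      -- determinism identifies the node reached by `split` with the one whose normal form is given.
      ext-rule : E (ext s n m) → Normal n a → Normal m b → ExtRuleᶜ Ext (s , a , b)
      ext-rule e h h′ with Normal-unfold h | Normal-unfold h′
      ... | div _ | div _ = ext-●
      ... | div d | conv c′ _ = ⊥-elim (ext-Diverges e d (_ , _ , c′))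
      ... | conv c x | div d′ with split-div e c d′
      ext-rule e _ _ | conv c ret | div _ | _ , _ , refl , e′ , d′ =
        ret-div ExtRel ExtRel⊆Ext (diverges em (λ _ _ x → x) e′ d′)
      ext-rule e _ _ | conv c x | conv c′ x′ with split e c′
      ext-rule e _ _ | conv c x | conv c′ x′ | ret c₁ _ e′ c₂ _ with ⇣-deterministic c c₁
      ext-rule e _ _ | conv _ ret | conv _ x′ | ret _ _ e′ c₂ _ | refl =
        ret-conv ExtRel ExtRel⊆Ext (converge em (λ _ _ x → x) _ _ ≤-refl e′ c₂ x′)
      ext-rule e _ _ | conv c x | conv c′ x′ | inp c₁ _ e′ with ⇣-deterministic c c₁
      ext-rule e _ _ | conv _ (inp x) | conv _ (inp x′) | inp _ _ e′ | refl =
        ext-in λ v → _ , _ , e′ v , x v , x′ v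
      ext-rule e _ _ | conv c x | conv c′ x′ | out c₁ _ e′ with ⇣-deterministic c c₁
      ext-rule e _ _ | conv _ (out x) | conv _ (out x′) | out _ _ e′ | refl =
        ext-out (_ , _ , e′ , x , x′)

      Ext⊆⇒* : ∀ {s} r r′ → Ext (s , stepᶜ r , stepᶜ r′) → ⟨ s , r ⟩⇒* r′
      Ext⊆⇒* _ _ x = record { Carrier   = Ext
                            ; postfixed = λ (_ , _ , e , h , h′) → ext-rule e h h′
                            ; seed      = x }

      eval⇒Evalᶜ : E (eval s σ n) → Normal n a → Evalᶜ s σ a
      eval⇒Evalᶜ e h with Normal-unfold h
      ... | conv c x = conv (converge em Ext⊆⇒* _ _ ≤-refl e c x)
      ... | div d    = div (diverges em Ext⊆⇒* e d)

proposition7p2 : ExcludedMiddle 0ℓ →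
    (L : Language) → let open Semantics L in
    (s : Stmt) (σ : State) (r : Res) (h : r ⇕) →
    ⟨ s , σ ⟩⇒ r → ⟨ s , σ ⟩⇒ᶜ norm r h
-- The coalgebra inside `e` serves as `E`, and its seed is the evaluation of `s` itself.
proposition7p2 em L s σ r h e = eval⇒Evalᶜ em seed (norm-Normal r h)
  where
  open ν e
  open Normalization L
  open Evaluation Carrier postfixed
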